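{- For every integer $k\ge 2$ there are integers $c=c(k)$ and $n_0=n_0(k)$ such that $F(n,k)=\delta(k)n+c$ for all $n\ge n_0$.
   Context: An oriented graph is a directed graph obtained by orienting each edge of a finite simple graph in exactly one of its two directions (so there are no loops, and at most one directed edge between any two vertices). A directed graph with at least $k+1$ vertices has property $S_k$ if for every $k$-set $B$ of vertices there is a vertex $u$ such that $B$ is contained in the outneighbourhood of $u$ (that is, there is a directed edge from $u$ to every element of $B$). $F(n,k)$ is the minimum number of edges in a graph of order $n$ (i.e. with $n$ vertices) that has an orientation with property $S_k$. $\delta(k)$ is the smallest positive integer $\delta$ such that some (finite) oriented graph with property $S_k$ has a vertex with indegree $\delta$. (It is known that for every $k$ there exist finite oriented graphs with property $S_k$.) -}

module Defs where

open import Level using (Level; 0ℓ)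
open import Data.Nat.Base using (ℕ; _≤_; _<_)
open import Data.Fin.Base using (Fin)
open import Data.Fin.Properties using (_<?_)
open import Data.Fin.Subset using (Subset; ∣_∣; _∈_)
open import Data.List.Base using (length; filter; allFin; cartesianProduct)
open import Data.Product using (_×_; _,_; ∃-syntax)
open import Data.Sum.Base using (_⊎_)
open import Relation.Binary.Core using (Rel)
open import Relation.Binary.Definitions
  using (Decidable; Symmetric; Irreflexive; Asymmetric)
open import Relation.Binary.PropositionalEquality using (_≡_)
open import Relation.Nullary.Decidable using (_×-dec_)

record Graph (n : ℕ) : Set₁ where
  field
    Adj    : Rel (Fin n) 0ℓ
    adj?   : Decidable Adj
    sym    : Symmetric Adj
    irrefl : Irreflexive _≡_ Adj

  -- Each edge {u , v} is counted once, as the pair with u < v.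
  size : ℕ
  size = length (filter (λ (u , v) → (u <? v) ×-dec adj? u v)
                        (cartesianProduct (allFin n) (allFin n)))

record Digraph (n : ℕ) : Set₁ where
  infix 4 _⟶_ _⟶?_
  field
    _⟶_  : Rel (Fin n) 0ℓ
    _⟶?_ : Decidable _⟶_

  indegree : Fin n → ℕ
  indegree v = length (filter (_⟶? v) (allFin n))

record IsOrientationOf {n : ℕ} (D : Digraph n) (G : Graph n) : Set where
  open Digraph D
  open Graph G
  field
    sound    : ∀ {u v} → u ⟶ v → Adj u v
    complete : ∀ {u v} → Adj u v → (u ⟶ v) ⊎ (v ⟶ u)
    asym     : Asymmetric _⟶_

IsOriented : {n : ℕ} → Digraph n → Set₁
IsOriented {n} D = ∃[ G ] IsOrientationOf D G

PropertyS : (k : ℕ) {n : ℕ} → Digraph n → Set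
PropertyS k {n} D =
  k < n × (∀ (B : Subset n) → ∣ B ∣ ≡ k → ∃[ u ] (∀ {v} → v ∈ B → u ⟶ v))
  where open Digraph D

IsLeast : {ℓ : Level} → (ℕ → Set ℓ) → ℕ → Set ℓ
IsLeast P m = P m × (∀ {m′} → P m′ → m ≤ m′)

-- The minima F(n,k) and δ(k) are given as relations: they are minima of
-- predicates that are not known in advance to be inhabited (for F and small n)
-- or decidable (for δ).

-- IsF n k m  means  F(n,k) = m.
IsF : (n k m : ℕ) → Set₁
IsF n k = IsLeast λ m →
  ∃[ G ] (Graph.size {n} G ≡ m × ∃[ D ] (IsOrientationOf D G × PropertyS k D))

-- Isδ k d  means  δ(k) = d.
Isδ : (k d : ℕ) → Set₁
Isδ k = IsLeast λ d →
  0 < d × ∃[ n ] ∃[ D ] (IsOriented {n} D × PropertyS k D ×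
                         ∃[ v ] (Digraph.indegree D v ≡ d))

{-# OPTIONS --safe #-}

-- Let m(n) be the least number of arcs on n vertices.  Since every indegree is
-- at least δ, and duplicating a vertex of indegree δ preserves S_k at a cost of
-- δ arcs, m(n) − δ n is bounded.  Hence for large n a minimal digraph has a
-- vertex of indegree δ, and m(n+1) ≤ m(n) + δ.  Conversely, bounded excess
-- bounds all indegrees by some r, and then, by a branching argument on
-- inneighbourhoods (this uses k ≥ 2), a set of vertices whose size depends only
-- on r suffices to dominate all k-sets.  For large n some vertex lies outside
-- it, and deleting it gives m(n) + δ ≤ m(n+1).  The thresholds are explicit, so
-- the eventual value of m(n) − δ n is computable.

module Submission where

open import Data.Nat.Base using (ℕ; _≥_)
open import Data.Integer.Base using (ℤ; +_; _+_; _*_)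
open import Data.Product using (_×_; Σ-syntax; ∃-syntax)
open import Relation.Binary.PropositionalEquality using (_≡_)
open import Defs

open import Data.Bool.Base using (true; if_then_else_)
open import Data.Bool.Properties using () renaming (_≟_ to _≟ᵇ_)
open import Data.Empty using (⊥)
open import Data.Fin.Base using (Fin; zero; suc; punchIn; punchOut; combine; remQuot)
open import Data.Fin.Properties using (any?; _<?_; <-cmp; <-asym; ¬∀⟶∃¬; injective⇒≤; punchIn-punchOut; remQuot-combine) renaming (_≟_ to _≟ᶠ_; all? to allFin?)
open import Data.Fin.Subset using (Subset; inside; outside; ∣_∣; ⁅_⁆; _∪_; _⊆_) renaming (_∈_ to _∈ₛ_; ⊥ to ⊥ₛ)
open import Data.Fin.Subset.Properties using (anySubset?; x∈⁅x⁆; ∣⁅x⁆∣≡1; ∣⊥∣≡0; p⊆p∪q; q⊆p∪q; ∣p∣≤n)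
open import Data.Integer.Base using (_-_)
open import Data.Integer.Properties using (pos-*)
open import Data.Integer.Tactic.RingSolver using (solve-∀)
open import Data.List.Base as List using (List; []; _∷_; _++_; length; filter; allFin; tabulate; cartesianProduct; concatMap; map)
open import Data.List.Membership.Propositional using (_∈_; _∉_; find)
open import Data.List.Membership.Propositional.Properties using (∈-filter⁺; ∈-allFin; ∈-length; ∈-concatMap⁺)
open import Data.List.Properties using (length-++; filter-++; map-tabulate; filter-notAll)
open import Data.List.Relation.Unary.All as All using (All)
open import Data.List.Relation.Unary.Any as Any using (Any; here; there)
open import Data.List.Relation.Unary.Any.Properties using (lookup-index)
open import Data.Nat.Base as ℕ using (zero; suc; _∸_; _≤_; _<_; z≤n; s≤s; s≤s⁻¹)
open import Data.Nat.Induction using (<-rec)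
open import Data.Nat.Properties as ℕₚ using (+-0-commutativeMonoid; ≤-refl; ≤-trans; ≤-reflexive; module ≤-Reasoning)
open import Data.Product using (_,_; proj₁; proj₂; ∃; uncurry)
open import Data.Sum.Base as Sum using (_⊎_; inj₁; inj₂; [_,_]′)
open import Data.Vec.Base as Vec using (Vec; []; _∷_; lookup; replicate)
open import Data.Vec.Properties using (lookup∘tabulate)
import Data.Vec.Membership.Propositional as VecMembership
import Data.Vec.Membership.Propositional.Properties as VecMembershipₚ
open import Data.Vec.Relation.Unary.All as VecAll using ([]; _∷_) renaming (All to VAll)
import Data.Vec.Relation.Unary.All.Properties as VecAllₚ
import Data.Vec.Relation.Unary.Any as VecAny
open import Function.Base using (_∘_; id)
open import Function.Bundles using (_⇔_; mk⇔; Equivalence)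
open import Relation.Binary.Definitions using (Asymmetric; tri<; tri≈; tri>)
open import Relation.Binary.PropositionalEquality using (_≢_; refl; sym; trans; cong; cong₂; subst; module ≡-Reasoning)
open import Relation.Nullary.Decidable using (Dec; yes; no; does; map′; ¬?; _×-dec_; _⊎-dec_; _→-dec_; does-⇔; decidable-stable; dec-true)
open import Relation.Nullary.Negation using (¬_; contradiction)
open import Relation.Unary using (Pred; Decidable)
open import Algebra.Properties.CommutativeMonoid.Sum +-0-commutativeMonoid using (sum; sum-syntax; sum-cong-≗; sum-remove; ∑-distrib-+; ∑-comm)

open Digraph using (_⟶_; _⟶?_; indegree)

private variable
  k m n r : ℕ

-- Counting by sums of indicators

𝟙 : {A : Set} → Dec A → ℕ
𝟙 a? = if does a? then 1 else 0

𝟙-⇔ : {A B : Set} (a? : Dec A) (b? : Dec B) → A ⇔ B → 𝟙 a? ≡ 𝟙 b?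
𝟙-⇔ a? b? A⇔B = cong (λ b → if b then 1 else 0) (does-⇔ A⇔B a? b?)

𝟙-⊎ : {A B C : Set} (a? : Dec A) (b? : Dec B) (c? : Dec C) →
      (C → A ⊎ B) → (A ⊎ B → C) → ¬ (A × B) → 𝟙 c? ≡ 𝟙 a? ℕ.+ 𝟙 b?
𝟙-⊎ (yes a) (yes b) c?      to from disjoint = contradiction (a , b) disjoint
𝟙-⊎ (yes a) (no ¬b) (yes c) to from disjoint = refl
𝟙-⊎ (yes a) (no ¬b) (no ¬c) to from disjoint = contradiction (from (inj₁ a)) ¬c
𝟙-⊎ (no ¬a) (yes b) (yes c) to from disjoint = refl
𝟙-⊎ (no ¬a) (yes b) (no ¬c) to from disjoint = contradiction (from (inj₂ b)) ¬c
𝟙-⊎ (no ¬a) (no ¬b) (yes c) to from disjoint = contradiction (to c) [ ¬a , ¬b ]′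
𝟙-⊎ (no ¬a) (no ¬b) (no ¬c) to from disjoint = refl

length-filter-tabulate : {A : Set} {P : Pred A _} (P? : Decidable P) (f : Fin n → A) →
                         length (filter P? (tabulate f)) ≡ ∑[ i < n ] 𝟙 (P? (f i))
length-filter-tabulate {zero}  P? f = refl
length-filter-tabulate {suc n} P? f with P? (f zero)
... | yes _ = cong suc (length-filter-tabulate P? (f ∘ suc))
... | no  _ = length-filter-tabulate P? (f ∘ suc)

length-filter-cartesianProduct :
  {A B : Set} {P : Pred (A × B) _} (P? : Decidable P) (f : Fin m → A) (g : Fin n → B) →
  length (filter P? (cartesianProduct (tabulate f) (tabulate g))) ≡
  ∑[ i < m ] ∑[ j < n ] 𝟙 (P? (f i , g j))
length-filter-cartesianProduct {zero}  P? f g = refl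
length-filter-cartesianProduct {suc m} P? f g = begin
  length (filter P? (row ++ rest))
    ≡⟨ cong length (filter-++ P? row rest) ⟩
  length (filter P? row ++ filter P? rest)
    ≡⟨ length-++ (filter P? row) ⟩
  length (filter P? row) ℕ.+ length (filter P? rest)
    ≡⟨ cong₂ ℕ._+_
         (trans (cong (length ∘ filter P?) (map-tabulate g (f zero ,_)))
                (length-filter-tabulate P? (λ j → f zero , g j)))
         (length-filter-cartesianProduct P? (f ∘ suc) g) ⟩
  _ ∎
  where
  open ≡-Reasoning
  row  = map (f zero ,_) (tabulate g)
  rest = cartesianProduct (tabulate (f ∘ suc)) (tabulate g)

∑∑-distrib-+ : (f g : Fin m → Fin n → ℕ) →
  (∑[ i < m ] ∑[ j < n ] (f i j ℕ.+ g i j)) ≡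
  (∑[ i < m ] ∑[ j < n ] f i j) ℕ.+ (∑[ i < m ] ∑[ j < n ] g i j)
∑∑-distrib-+ f g =
  trans (sum-cong-≗ (λ i → ∑-distrib-+ (f i) (g i))) (∑-distrib-+ (sum ∘ f) (sum ∘ g))

sum-mono-≤ : {f g : Fin n → ℕ} → (∀ i → f i ≤ g i) → sum f ≤ sum g
sum-mono-≤ {zero}  f≤g = z≤n
sum-mono-≤ {suc n} f≤g = ℕₚ.+-mono-≤ (f≤g zero) (sum-mono-≤ (f≤g ∘ suc))

n*c≤sum : ∀ {c} {f : Fin n → ℕ} → (∀ i → c ≤ f i) → n ℕ.* c ≤ sum f
n*c≤sum {zero}  c≤f = z≤n
n*c≤sum {suc n} c≤f = ℕₚ.+-mono-≤ (c≤f zero) (n*c≤sum (c≤f ∘ suc))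

arcs : Digraph n → ℕ
arcs D = sum (indegree D)

indegree≡∑ : (D : Digraph n) (v : Fin n) → indegree D v ≡ ∑[ u < n ] 𝟙 (_⟶?_ D u v)
indegree≡∑ D v = length-filter-tabulate (λ u → _⟶?_ D u v) id

indegree-cong : (D E : Digraph n) → (∀ u v → _⟶_ D u v ⇔ _⟶_ E u v) →
                ∀ v → indegree D v ≡ indegree E v
indegree-cong {n} D E D⇔E v = begin
  indegree D v                      ≡⟨ indegree≡∑ D v ⟩
  (∑[ u < n ] 𝟙 (_⟶?_ D u v))       ≡⟨ sum-cong-≗ {n} (λ u → 𝟙-⇔ (_⟶?_ D u v) (_⟶?_ E u v) (D⇔E u v)) ⟩
  (∑[ u < n ] 𝟙 (_⟶?_ E u v))       ≡⟨ indegree≡∑ E v ⟨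
  indegree E v                      ∎
  where open ≡-Reasoning

-- An edge {u , v} with u < v is counted by size at (u , v), whereas the arc it
-- becomes may be counted at (u , v) or at (v , u).
size≡arcs : {D : Digraph n} {G : Graph n} → IsOrientationOf D G → Graph.size G ≡ arcs D
size≡arcs {n} {D} {G} D-orients = begin
  Graph.size G
    ≡⟨ length-filter-cartesianProduct (λ (u , v) → (u <? v) ×-dec adj? u v) id id ⟩
  (∑[ u < n ] ∑[ v < n ] 𝟙 ((u <? v) ×-dec adj? u v))
    ≡⟨ sum-cong-≗ {n} (λ u → sum-cong-≗ {n} (λ v → edge-split u v)) ⟩
  (∑[ u < n ] ∑[ v < n ] (up u v ℕ.+ down v u))
    ≡⟨ ∑∑-distrib-+ up (λ u v → down v u) ⟩
  (∑[ u < n ] ∑[ v < n ] up u v) ℕ.+ (∑[ u < n ] ∑[ v < n ] down v u)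
    ≡⟨ cong₂ ℕ._+_ (∑-comm up) refl ⟩
  (∑[ v < n ] ∑[ u < n ] up u v) ℕ.+ (∑[ v < n ] ∑[ u < n ] down u v)
    ≡⟨ ∑∑-distrib-+ (λ v u → up u v) (λ v u → down u v) ⟨
  (∑[ v < n ] ∑[ u < n ] (up u v ℕ.+ down u v))
    ≡⟨ sum-cong-≗ {n} (λ v → sum-cong-≗ {n} (λ u → arc-split u v)) ⟨
  (∑[ v < n ] ∑[ u < n ] 𝟙 (_⟶?_ D u v))
    ≡⟨ sum-cong-≗ (indegree≡∑ D) ⟨
  arcs D ∎
  where
  open ≡-Reasoning
  open Graph G using (adj?)
  open IsOrientationOf D-orients

  up down : Fin n → Fin n → ℕ
  up   u v = 𝟙 ((u <? v) ×-dec _⟶?_ D u v)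
  down u v = 𝟙 ((v <? u) ×-dec _⟶?_ D u v)

  edge-split : ∀ u v → 𝟙 ((u <? v) ×-dec adj? u v) ≡ up u v ℕ.+ down v u
  edge-split u v = 𝟙-⊎ ((u <? v) ×-dec _⟶?_ D u v) ((u <? v) ×-dec _⟶?_ D v u) ((u <? v) ×-dec adj? u v)
    (λ (u<v , uv) → Sum.map (u<v ,_) (u<v ,_) (complete uv))
    [ (λ (u<v , uv) → u<v , sound uv) , (λ (u<v , vu) → u<v , Graph.sym G (sound vu)) ]′
    (λ ((_ , uv) , (_ , vu)) → asym uv vu)

  arc-split : ∀ u v → 𝟙 (_⟶?_ D u v) ≡ up u v ℕ.+ down u v
  arc-split u v = 𝟙-⊎ ((u <? v) ×-dec _⟶?_ D u v) ((v <? u) ×-dec _⟶?_ D u v) (_⟶?_ D u v) compare [ proj₂ , proj₂ ]′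
    (λ ((u<v , _) , (v<u , _)) → <-asym u<v v<u)
    where
    compare : _⟶_ D u v → _
    compare uv with <-cmp u v
    ... | tri< u<v _ _  = inj₁ (u<v , uv)
    ... | tri≈ _ refl _ = contradiction uv (asym uv)
    ... | tri> _ _ v<u  = inj₂ (v<u , uv)

-- Property S_k for k-tuples

-- Entries may repeat, so the property pulls back along maps of vertices that are not injective,
-- such as the one sending a copied vertex to its original. For `k < n` it is equivalent to
-- `PropertyS k D`.
Dominating : ℕ → Digraph n → Set
Dominating {n} k D = (xs : Vec (Fin n) k) → ∃[ u ] VAll (_⟶_ D u) xs

elements : (p : Subset n) → Vec (Fin n) ∣ p ∣
elements []            = []
elements (inside  ∷ p) = zero ∷ Vec.map suc (elements p)
elements (outside ∷ p) = Vec.map suc (elements p)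

∈-elements : (p : Subset n) {x : Fin n} → x ∈ₛ p → x VecMembership.∈ elements p
∈-elements (inside  ∷ p) Vec.here        = VecAny.here refl
∈-elements (inside  ∷ p) (Vec.there x∈p) = VecAny.there (VecMembershipₚ.∈-map⁺ suc (∈-elements p x∈p))
∈-elements (outside ∷ p) (Vec.there x∈p) = VecMembershipₚ.∈-map⁺ suc (∈-elements p x∈p)

∣p∪q∣≤∣p∣+∣q∣ : (p q : Subset n) → ∣ p ∪ q ∣ ≤ ∣ p ∣ ℕ.+ ∣ q ∣
∣p∪q∣≤∣p∣+∣q∣ []            []            = z≤n
∣p∪q∣≤∣p∣+∣q∣ (outside ∷ p) (outside ∷ q) = ∣p∪q∣≤∣p∣+∣q∣ p q
∣p∪q∣≤∣p∣+∣q∣ (outside ∷ p) (inside  ∷ q) =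
  ≤-trans (s≤s (∣p∪q∣≤∣p∣+∣q∣ p q)) (≤-reflexive (sym (ℕₚ.+-suc ∣ p ∣ ∣ q ∣)))
∣p∪q∣≤∣p∣+∣q∣ (inside  ∷ p) (outside ∷ q) = s≤s (∣p∪q∣≤∣p∣+∣q∣ p q)
∣p∪q∣≤∣p∣+∣q∣ (inside  ∷ p) (inside  ∷ q) =
  s≤s (≤-trans (∣p∪q∣≤∣p∣+∣q∣ p q) (ℕₚ.+-monoʳ-≤ ∣ p ∣ (ℕₚ.n≤1+n ∣ q ∣)))

enlarge : (p : Subset n) → ∣ p ∣ ≤ k → k ≤ n → ∃[ q ] (p ⊆ q × ∣ q ∣ ≡ k)
enlarge {k = zero}  []            _         _         = [] , id , refl
enlarge {k = suc _} (inside  ∷ p) (s≤s p≤k) (s≤s k≤n) =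
  let q , p⊆q , q≡k = enlarge p p≤k k≤n in
  inside ∷ q , (λ { Vec.here → Vec.here ; (Vec.there x∈p) → Vec.there (p⊆q x∈p) }) , cong suc q≡k
enlarge {suc n} {k} (outside ∷ p) p≤k k≤1+n with ℕₚ.m≤n⇒m<n∨m≡n k≤1+n
... | inj₁ (s≤s k≤n) =
  let q , p⊆q , q≡k = enlarge p p≤k k≤n in
  outside ∷ q , (λ { (Vec.there x∈p) → Vec.there (p⊆q x∈p) }) , q≡k
-- Here the whole vertex set has to be taken, so `zero` goes in although it is not in `p`.
... | inj₂ refl =
  let q , p⊆q , q≡n = enlarge p (∣p∣≤n p) ≤-refl in
  inside ∷ q , (λ { (Vec.there x∈p) → Vec.there (p⊆q x∈p) }) , cong suc q≡n

range : (xs : Vec (Fin n) k) → ∃[ p ] (∣ p ∣ ≤ k × VAll (_∈ₛ p) xs)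
range {n} []       = ⊥ₛ , ≤-reflexive (∣⊥∣≡0 n) , []
range     (x ∷ xs) =
  let p , p≤k , xs∈p = range xs in
  ⁅ x ⁆ ∪ p ,
  ≤-trans (∣p∪q∣≤∣p∣+∣q∣ ⁅ x ⁆ p) (ℕₚ.+-mono-≤ (≤-reflexive (∣⁅x⁆∣≡1 x)) p≤k) ,
  p⊆p∪q p (x∈⁅x⁆ x) ∷ VecAll.map (q⊆p∪q ⁅ x ⁆ p) xs∈p

-- A tuple with repetitions has fewer than `k` distinct entries; its range is padded to a `k`-set,
-- for which `k < n` leaves room.
propertyS⇒dominating : (D : Digraph n) → PropertyS k D → Dominating k D
propertyS⇒dominating D (k<n , S) xs =
  let p , p≤k , xs∈p = range xs
      q , p⊆q , q≡k  = enlarge p p≤k (ℕₚ.<⇒≤ k<n)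
      u , u⟶q        = S q q≡k
  in u , VecAll.map (λ x∈p → u⟶q (p⊆q x∈p)) xs∈p

dominating⇒propertyS : (D : Digraph n) → k < n → Dominating k D → PropertyS k D
dominating⇒propertyS D k<n dom = k<n , λ { B refl →
  let u , u⟶B = dom (elements B) in u , λ v∈B → VecAll.lookup u⟶B (∈-elements B v∈B) }

-- Least arc counts in place of least sizes

underlying : (D : Digraph n) → Asymmetric (_⟶_ D) → Graph n
underlying D asym = record
  { Adj    = λ u v → _⟶_ D u v ⊎ _⟶_ D v u
  ; adj?   = λ u v → _⟶?_ D u v ⊎-dec _⟶?_ D v u
  ; sym    = Sum.swap
  ; irrefl = λ { refl → [ (λ uu → asym uu uu) , (λ uu → asym uu uu) ]′ }
  }

orients-underlying : (D : Digraph n) (asym : Asymmetric (_⟶_ D)) →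
                     IsOrientationOf D (underlying D asym)
orients-underlying D asym = record { sound = inj₁ ; complete = id ; asym = asym }

-- The graph is dropped: `underlying` recovers it from an asymmetric digraph, and by `size≡arcs` its
-- size is the number of arcs.
Realizes : (n k m : ℕ) → Digraph n → Set
Realizes n k m D = Asymmetric (_⟶_ D) × Dominating k D × arcs D ≡ m

Realizable : (n k m : ℕ) → Set₁
Realizable n k m = ∃[ D ] Realizes n k m D

leastRealizable⇒IsF : k < n → IsLeast (Realizable n k) m → IsF n k m
leastRealizable⇒IsF k<n ((D , asym , dom , D≡m) , least) =
  (underlying D asym , trans (size≡arcs D-orients) D≡m , D , D-orients , dominating⇒propertyS D k<n dom) ,
  λ { (G , G≡m′ , E , E-orients , S) →
      least (E , IsOrientationOf.asym E-orients , propertyS⇒dominating E S ,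
             trans (sym (size≡arcs E-orients)) G≡m′) }
  where D-orients = orients-underlying D asym

-- Decidability

anyVec? : {A : Set} → (∀ {P : A → Set} → Decidable P → Dec (∃ P)) →
          {P : Vec A k → Set} → Decidable P → Dec (∃ P)
anyVec? {zero}  anyA? P? = map′ (λ p → [] , p) (λ { ([] , p) → p }) (P? [])
anyVec? {suc k} anyA? P? =
  map′ (λ (x , xs , p) → x ∷ xs , p) (λ { (x ∷ xs , p) → x , xs , p })
       (anyA? (λ x → anyVec? anyA? (λ xs → P? (x ∷ xs))))

dominating? : ∀ k (D : Digraph n) → Dec (Dominating k D)
dominating? k D =
  map′ (λ ¬bad xs → decidable-stable (dominated? xs) (λ ¬d → ¬bad (xs , ¬d)))
       (λ dom (xs , ¬d) → ¬d (dom xs))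
       (¬? (anyVec? any? (λ xs → ¬? (dominated? xs))))
  where
  dominated? : ∀ xs → Dec (∃[ u ] VAll (_⟶_ D u) xs)
  dominated? xs = any? (λ u → VecAll.all? (_⟶?_ D u) xs)

realizes? : ∀ n k m (D : Digraph n) → Dec (Realizes n k m D)
realizes? n k m D = asym? ×-dec dominating? k D ×-dec (arcs D ℕₚ.≟ m)
  where
  asym? = map′ (λ asym {u} {v} → asym u v) (λ asym u v → asym)
    (allFin? λ u → allFin? λ v → _⟶?_ D u v →-dec ¬? (_⟶?_ D v u))

-- Relations into `Set` cannot be enumerated, whereas subsets of the `n * n` pairs can. Every
-- digraph has the same arcs as a decoded one, so a search over subsets decides `Realizable`.
decode : Subset (n ℕ.* n) → Digraph n
decode p = record
  { _⟶_  = λ u v → lookup p (combine u v) ≡ true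
  ; _⟶?_ = λ u v → lookup p (combine u v) ≟ᵇ true
  }

encode : Digraph n → Subset (n ℕ.* n)
encode {n} D = Vec.tabulate (λ i → does (uncurry (_⟶?_ D) (remQuot n i)))

decode-encode : (D : Digraph n) → ∀ u v → _⟶_ D u v ⇔ _⟶_ (decode (encode D)) u v
decode-encode {n} D u v = mk⇔ (λ uv → trans lookup≡ (dec-true (_⟶?_ D u v) uv)) from
  where
  lookup≡ : lookup (encode D) (combine u v) ≡ does (_⟶?_ D u v)
  lookup≡ = trans (lookup∘tabulate _ (combine u v))
                  (cong (λ ij → does (uncurry (_⟶?_ D) ij)) (remQuot-combine u v))

  from : _⟶_ (decode (encode D)) u v → _⟶_ D u v
  from eq with _⟶?_ D u v | trans (sym lookup≡) eq
  ... | yes uv | _ = uv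

realizes-resp-⇔ : {D E : Digraph n} → (∀ u v → _⟶_ D u v ⇔ _⟶_ E u v) →
                  Realizes n k m D → Realizes n k m E
realizes-resp-⇔ {D = D} {E} D⇔E (asym , dom , D≡m) =
  (λ uv vu → asym (from uv) (from vu)) ,
  (λ xs → let u , u⟶xs = dom xs in u , VecAll.map to u⟶xs) ,
  trans (sym (sum-cong-≗ (indegree-cong D E D⇔E))) D≡m
  where
  to : ∀ {u v} → _⟶_ D u v → _⟶_ E u v
  to {u} {v} = Equivalence.to (D⇔E u v)
  from : ∀ {u v} → _⟶_ E u v → _⟶_ D u v
  from {u} {v} = Equivalence.from (D⇔E u v)

realizable? : ∀ n k m → Dec (Realizable n k m)
realizable? n k m =
  map′ (λ (p , Rp) → decode p , Rp)
       (λ (D , RD) → encode D , realizes-resp-⇔ (decode-encode D) RD)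
       (anySubset? (λ p → realizes? n k m (decode p)))

least : ∀ {ℓ} {P : ℕ → Set ℓ} → Decidable P → P m → ∃[ l ] IsLeast P l
least {m} {P = P} P? = <-rec (λ m → P m → ∃[ l ] IsLeast P l) search m
  where
  search : ∀ m → (∀ {l} → l < m → P l → ∃[ l ] IsLeast P l) → P m → ∃[ l ] IsLeast P l
  search m rec Pm with ℕₚ.anyUpTo? P? m
  ... | yes (l , l<m , Pl) = rec l<m Pl
  ... | no  ¬smaller       = m , Pm , λ {l} Pl → ℕₚ.≮⇒≥ (λ l<m → ¬smaller (l , l<m , Pl))

-- Adding and deleting a vertex

module _ (D : Digraph n) (v : Fin n) where

  private
    original : Fin (suc n) → Fin n
    original zero    = v
    original (suc u) = u

    Arc : Fin (suc n) → Fin (suc n) → Set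
    Arc zero    w = ⊥
    Arc (suc u) w = _⟶_ D u (original w)

    arc? : ∀ u w → Dec (Arc u w)
    arc? zero    w = no λ ()
    arc? (suc u) w = _⟶?_ D u (original w)

  -- The copy is given no outgoing arcs, so that old indegrees stay the same and exactly
  -- `indegree D v` arcs are added; the old vertices do all the dominating.
  duplicate : Digraph (suc n)
  duplicate = record { _⟶_ = Arc ; _⟶?_ = arc? }

  indegree-duplicate : ∀ w → indegree duplicate w ≡ indegree D (original w)
  indegree-duplicate w =
    -- The summand of `zero` reduces to 0, so the two sums agree by computation.
    trans (indegree≡∑ duplicate w) (sym (indegree≡∑ D (original w)))

  duplicate-realizes : Realizes n k m D →
                       Realizes (suc n) k (indegree D v ℕ.+ m) duplicate
  duplicate-realizes (asym , dom , refl) =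
    (λ { {suc u} {suc w} → asym }) ,
    (λ xs → let u , u⟶xs = dom (Vec.map original xs) in suc u , VecAllₚ.map⁻ u⟶xs) ,
    sum-cong-≗ indegree-duplicate

delete : Digraph (suc n) → Fin (suc n) → Digraph n
delete D w = record
  { _⟶_  = λ u v → _⟶_ D (punchIn w u) (punchIn w v)
  ; _⟶?_ = λ u v → _⟶?_ D (punchIn w u) (punchIn w v)
  }

-- Only an inequality, because the outgoing arcs of `w` disappear too and lower other indegrees.
arcs-delete : (D : Digraph (suc n)) (w : Fin (suc n)) →
              indegree D w ℕ.+ arcs (delete D w) ≤ arcs D
arcs-delete D w = begin
  indegree D w ℕ.+ arcs (delete D w)
    ≤⟨ ℕₚ.+-monoʳ-≤ (indegree D w) (sum-mono-≤ indegree-delete) ⟩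
  indegree D w ℕ.+ sum (indegree D ∘ punchIn w)
    ≡⟨ sum-remove {i = w} (indegree D) ⟨
  arcs D ∎
  where
  open ≤-Reasoning
  indegree-delete : ∀ v → indegree (delete D w) v ≤ indegree D (punchIn w v)
  indegree-delete v = begin
    indegree (delete D w) v
      ≡⟨ indegree≡∑ (delete D w) v ⟩
    sum (λ u → 𝟙 (_⟶?_ D (punchIn w u) (punchIn w v)))
      ≤⟨ ℕₚ.m≤n+m _ _ ⟩
    𝟙 (_⟶?_ D w (punchIn w v)) ℕ.+ sum (λ u → 𝟙 (_⟶?_ D (punchIn w u) (punchIn w v)))
      ≡⟨ sum-remove {i = w} (λ u → 𝟙 (_⟶?_ D u (punchIn w v))) ⟨
    sum (λ u → 𝟙 (_⟶?_ D u (punchIn w v)))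
      ≡⟨ indegree≡∑ D (punchIn w v) ⟨
    indegree D (punchIn w v) ∎

-- Kernels

DominatingFrom : List (Fin n) → ℕ → Digraph n → Set
DominatingFrom {n} K k D = (xs : Vec (Fin n) k) → ∃[ u ] (u ∈ K × VAll (_⟶_ D u) xs)

-- The dominators found in `K` differ from `w`, so they survive its deletion.
delete-dominating : (D : Digraph (suc n)) {K : List (Fin (suc n))} {w : Fin (suc n)} →
                    w ∉ K → DominatingFrom K k D → Dominating k (delete D w)
delete-dominating D {w = w} w∉K dom xs with dom (Vec.map (punchIn w) xs)
... | u , u∈K , u⟶xs =
  punchOut w≢u , VecAll.map (subst (λ u → _⟶_ D u _) (sym (punchIn-punchOut w≢u))) (VecAllₚ.map⁻ u⟶xs)
  where
  w≢u : w ≢ u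
  w≢u refl = w∉K u∈K

-- This is r + r² + ... + r^d, the number of non-root vertices of a tree of depth `d` with branching
-- `r`: each branch costs its chosen vertex and a kernel for one remaining inneighbour fewer.
kernelSize : ℕ → ℕ → ℕ
kernelSize r zero    = 0
kernelSize r (suc d) = r ℕ.* suc (kernelSize r d)

length-concatMap-≤ : {A B : Set} {f : A → List B} {b : ℕ} → (∀ x → length (f x) ≤ b) →
                     ∀ xs → length (concatMap f xs) ≤ length xs ℕ.* b
length-concatMap-≤         f≤b []       = z≤n
length-concatMap-≤ {f = f} f≤b (x ∷ xs) =
  ≤-trans (≤-reflexive (length-++ (f x))) (ℕₚ.+-mono-≤ (f≤b x) (length-concatMap-≤ f≤b xs))

module _ (D : Digraph n) (indegree≤r : ∀ v → indegree D v ≤ r)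
         (dom : Dominating (suc (suc k)) D) where

  -- T is a set of vertices already chosen inside the inneighbourhood of v, and
  -- rs lists what remains of it.  If T does not yet meet the common
  -- inneighbourhood of some tuple x ∷ xs, then one of the at most r
  -- inneighbours of x can be moved from rs to T.
  partialKernel : ∀ d (T : List (Fin n)) →
    ∃[ K ] (length K ≤ kernelSize r d ×
            (∀ v rs → All (λ t → _⟶_ D t v) T → length rs ≤ d →
             (∀ {u} → _⟶_ D u v → u ∈ T ⊎ u ∈ rs) →
             (xs : Vec (Fin n) (suc k)) →
             ∃[ u ] ((u ∈ T ⊎ u ∈ K) × VAll (_⟶_ D u) (v ∷ xs))))
  partialKernel zero T = [] , z≤n , finish
    where
    finish : ∀ v rs → _ → length rs ≤ 0 → (∀ {u} → _⟶_ D u v → u ∈ T ⊎ u ∈ rs) → ∀ xs → _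
    -- Nothing remains outside `T`, so every inneighbour of `v`, and with it the dominator of
    -- `v ∷ xs`, lies in `T`.
    finish v [] _ _ cover xs with dom (v ∷ xs)
    ... | u , u⟶v ∷ u⟶xs = u , inj₁ ([ id , (λ ()) ]′ (cover u⟶v)) , u⟶v ∷ u⟶xs
  partialKernel (suc d) T
    -- The search involves `T` only, so the missed tuple, and hence `K`, serves all `v` at once. The
    -- tuple has `suc k` entries and thus a first entry `x`; this is where k ≥ 2 enters.
    with anyVec? {k = suc k} any? (λ xs → ¬? (Any.any? (λ t → VecAll.all? (_⟶?_ D t) xs) T))
  ... | no ¬missed = [] , z≤n , λ v rs T⟶v _ _ xs →
    let t∈T = decidable-stable (Any.any? (λ t → VecAll.all? (_⟶?_ D t) xs) T)
                               (λ ¬t → ¬missed (xs , ¬t))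
        t , t∈T , t⟶xs = find t∈T
    in t , inj₁ t∈T , All.lookup T⟶v t∈T ∷ t⟶xs
  ... | yes (x ∷ xs , missed) = concatMap branch nbrs , bound , choose
    where
    nbrs : List (Fin n)
    nbrs = filter (λ u → _⟶?_ D u x) (allFin n)

    branch : Fin n → List (Fin n)
    branch h = h ∷ proj₁ (partialKernel d (h ∷ T))

    bound : length (concatMap branch nbrs) ≤ r ℕ.* suc (kernelSize r d)
    bound = ≤-trans
      (length-concatMap-≤ (λ h → s≤s (proj₁ (proj₂ (partialKernel d (h ∷ T))))) nbrs)
      (ℕₚ.*-monoˡ-≤ (suc (kernelSize r d)) (indegree≤r x))

    choose : ∀ v rs → All (λ t → _⟶_ D t v) T → length rs ≤ suc d →
             (∀ {u} → _⟶_ D u v → u ∈ T ⊎ u ∈ rs) → ∀ ys →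
             ∃[ u ] ((u ∈ T ⊎ u ∈ concatMap branch nbrs) × VAll (_⟶_ D u) (v ∷ ys))
    choose v rs T⟶v rs≤ cover ys with dom (v ∷ x ∷ xs)
    -- As an inneighbour of `x`, the dominator `h` is one of the branches; as an inneighbour of `v`
    -- outside `T`, which misses the tuple, it must lie in `rs`.
    ... | h , h⟶v ∷ h⟶x ∷ h⟶xs =
      let u , u∈ , u⟶ = proj₂ (proj₂ (partialKernel d (h ∷ T))) v rs′ (h⟶v All.∷ T⟶v) rs′≤ cover′ ys
      in u , inKernel u∈ , u⟶
      where
      h∉T : h ∉ T
      h∉T h∈T = missed (Any.map (λ { refl → h⟶x ∷ h⟶xs }) h∈T)

      h∈rs : h ∈ rs
      h∈rs = [ (λ h∈T → contradiction h∈T h∉T) , id ]′ (cover h⟶v)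

      rs′ : List (Fin n)
      rs′ = filter (λ u → ¬? (u ≟ᶠ h)) rs

      rs′≤ : length rs′ ≤ d
      -- Since `h` occurs in `rs`, filtering it out shortens the list, which pays for the drop from
      -- `suc d` to `d`.
      rs′≤ = s≤s⁻¹ (≤-trans
        (filter-notAll (λ u → ¬? (u ≟ᶠ h)) rs (Any.map (λ h≡u u≢h → u≢h (sym h≡u)) h∈rs)) rs≤)

      cover′ : ∀ {u} → _⟶_ D u v → u ∈ h ∷ T ⊎ u ∈ rs′
      cover′ {u} u⟶v with u ≟ᶠ h
      ... | yes u≡h = inj₁ (here u≡h)
      ... | no  u≢h = Sum.map there (λ u∈rs → ∈-filter⁺ (λ u → ¬? (u ≟ᶠ h)) u∈rs u≢h) (cover u⟶v)

      inBranch : ∀ {u} → u ∈ branch h → u ∈ concatMap branch nbrs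
      inBranch u∈ = ∈-concatMap⁺ branch
        (Any.map (λ { refl → u∈ }) (∈-filter⁺ (λ u → _⟶?_ D u x) (∈-allFin h) h⟶x))

      inKernel : ∀ {u} → u ∈ h ∷ T ⊎ u ∈ proj₁ (partialKernel d (h ∷ T)) →
                 u ∈ T ⊎ u ∈ concatMap branch nbrs
      inKernel (inj₁ (here u≡h))  = inj₂ (inBranch (here u≡h))
      inKernel (inj₁ (there u∈T)) = inj₁ u∈T
      inKernel (inj₂ u∈K)         = inj₂ (inBranch (there u∈K))

  -- For the empty `T`, all inneighbours of the first entry `v` remain, at most `r` of them. So `r`
  -- bounds both the depth and the branching.
  kernel : ∃[ K ] (length K ≤ kernelSize r r × DominatingFrom K (suc (suc k)) D)
  kernel with partialKernel r []
  ... | K , K≤ , dominates = K , K≤ , λ { (v ∷ xs) →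
    let u , u∈ , u⟶ = dominates v (filter (λ u → _⟶?_ D u v) (allFin n)) All.[] (indegree≤r v)
                        (λ {u} u⟶v → inj₂ (∈-filter⁺ (λ u → _⟶?_ D u v) (∈-allFin u) u⟶v)) xs
    in u , [ (λ ()) , id ]′ u∈ , u⟶ }

length<⇒∃∉ : (xs : List (Fin n)) → length xs < n → ∃[ w ] w ∉ xs
length<⇒∃∉ {n} xs xs<n = ¬∀⟶∃¬ n (_∈ xs) (λ w → Any.any? (w ≟ᶠ_) xs)
  -- If all of `Fin n` were listed, sending each element to a position where it occurs would be
  -- injective.
  λ ∈xs → ℕₚ.<⇒≱ xs<n (injective⇒≤ (λ {i} {j} eq →
    trans (lookup-index (∈xs i)) (trans (cong (List.lookup xs) eq) (sym (lookup-index (∈xs j))))))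

-- Lower bound on indegrees, upper bound on arcs

dominating⇒0<indegree : (D : Digraph n) → Dominating (suc k) D → ∀ v → 0 < indegree D v
-- Any dominator of the constant tuple at `v` is an inneighbour of `v`. This gives the positivity
-- that `Isδ` asks for.
dominating⇒0<indegree {k = k} D dom v with dom (replicate (suc k) v)
... | u , u⟶v ∷ _ = ∈-length (∈-filter⁺ (λ u → _⟶?_ D u v) (∈-allFin u) u⟶v)

δ≤indegree : ∀ {δ} → Isδ (suc k) δ → suc k < n → (D : Digraph n) →
             Asymmetric (_⟶_ D) → Dominating (suc k) D → ∀ v → δ ≤ indegree D v
δ≤indegree {n = n} (_ , δ-least) k<n D asym dom v = δ-least
  (dominating⇒0<indegree D dom v , n , D , (underlying D asym , orients-underlying D asym) ,
   dominating⇒propertyS D k<n dom , v , refl)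

-- The vertex `w` is carried along so that the next duplication again costs `indegree D v` arcs.
iteratedDuplicate : {D : Digraph n} {v : Fin n} → Realizes n k m D → ∀ i →
  Σ[ E ∈ Digraph (i ℕ.+ n) ] (Realizes (i ℕ.+ n) k (i ℕ.* indegree D v ℕ.+ m) E ×
                             ∃[ w ] indegree E w ≡ indegree D v)
iteratedDuplicate {D = D} {v} RD zero    = D , RD , v , refl
iteratedDuplicate {n} {k} {m} {D} {v} RD (suc i) with iteratedDuplicate {v = v} RD i
... | E , RE , w , w≡ =
  duplicate E w ,
  subst (λ a → Realizes _ k a (duplicate E w))
        (trans (cong (ℕ._+ (i ℕ.* δ ℕ.+ m)) w≡) (sym (ℕₚ.+-assoc δ (i ℕ.* δ) m)))
        (duplicate-realizes E w RE) ,
  zero , trans (indegree-duplicate E w zero) w≡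
  where δ = indegree D v

-- Eventual linearity of the minimum

module _ {j δ n₁ a₁ : ℕ} (k<n₁ : suc (suc j) < n₁)
         (minδ : ∀ {n} → suc (suc j) < n → (D : Digraph n) →
                 Asymmetric (_⟶_ D) → Dominating (suc (suc j)) D → ∀ v → δ ≤ indegree D v)
         (exists : ∀ i → Realizable (i ℕ.+ n₁) (suc (suc j)) (i ℕ.* δ ℕ.+ a₁)) where

  private
    κ : ℕ
    κ = suc (suc j)

    Min : ℕ → ℕ → Set₁
    Min n = IsLeast (Realizable n κ)

  minExists : n₁ ≤ n → ∃[ F ] Min n F
  minExists {n} n₁≤n with n ∸ n₁ | ℕₚ.m∸n+n≡m n₁≤n
  ... | i | refl = least (realizable? _ κ) (exists i)

  -- Rounding `i * δ` up to `n * δ` leaves an excess `a₁` that does not depend on `n`.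
  upperBound : ∀ {F} → n₁ ≤ n → Min n F → F ≤ n ℕ.* δ ℕ.+ a₁
  upperBound {n} n₁≤n (_ , least) with n ∸ n₁ | ℕₚ.m∸n+n≡m n₁≤n
  ... | i | refl = ≤-trans (least (exists i))
    (ℕₚ.+-monoˡ-≤ a₁ (ℕₚ.*-monoˡ-≤ δ (ℕₚ.m≤m+n i n₁)))

  -- If all indegrees exceeded `δ`, there would be at least n(δ + 1) arcs, which is more than
  -- `n * δ + a₁` once `a₁ < n`. So some vertex has indegree `δ` and can be duplicated.
  stepUp : ∀ {F F′} → n₁ ≤ n → a₁ < n → Min n F → Min (suc n) F′ → F′ ≤ δ ℕ.+ F
  stepUp {n} {F} n₁≤n a₁<n min@((D , RD@(asym , dom , D≡F)) , _) (_ , least)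
    with any? (λ v → indegree D v ℕₚ.≟ δ)
  ... | yes (v , refl) = least (duplicate D v , duplicate-realizes D v RD)
  ... | no  ¬δ = contradiction n≤a₁ (ℕₚ.<⇒≱ a₁<n)
    where
    open ≤-Reasoning
    δ<indegree : ∀ v → suc δ ≤ indegree D v
    δ<indegree v = ℕₚ.≤∧≢⇒< (minδ (ℕₚ.<-≤-trans k<n₁ n₁≤n) D asym dom v) (λ eq → ¬δ (v , sym eq))
    n≤a₁ : n ≤ a₁
    n≤a₁ = ℕₚ.+-cancelˡ-≤ (n ℕ.* δ) n a₁ (begin
      n ℕ.* δ ℕ.+ n   ≡⟨ ℕₚ.+-comm (n ℕ.* δ) n ⟩
      n ℕ.+ n ℕ.* δ   ≡⟨ ℕₚ.*-suc n δ ⟨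
      n ℕ.* suc δ     ≤⟨ n*c≤sum δ<indegree ⟩
      arcs D          ≡⟨ D≡F ⟩
      F               ≤⟨ upperBound n₁≤n min ⟩
      n ℕ.* δ ℕ.+ a₁  ∎)

  -- Deleting a vertex outside a kernel removes at least `δ` arcs and leaves a dominating digraph,
  -- which has at least `F` arcs.
  stepDown : ∀ {F F′} → n₁ ≤ n → kernelSize (δ ℕ.+ a₁) (δ ℕ.+ a₁) ≤ n →
             Min n F → Min (suc n) F′ → δ ℕ.+ F ≤ F′
  stepDown {n} {F} {F′} n₁≤n kernel≤n (_ , least) min@((D , asym , dom , D≡F′) , _) =
    deleteOutside (length<⇒∃∉ _ (s≤s (≤-trans K≤ kernel≤n)))
    where
    open ≤-Reasoning
    n₁≤1+n = ℕₚ.m≤n⇒m≤1+n n₁≤n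
    δ≤ = minδ (ℕₚ.<-≤-trans k<n₁ n₁≤1+n) D asym dom

    -- The other `n` vertices have indegree at least `δ` each; at worst the whole excess over (n +
    -- 1)δ falls on `v`.
    indegree≤ : ∀ v → indegree D v ≤ δ ℕ.+ a₁
    indegree≤ v = ℕₚ.+-cancelʳ-≤ (n ℕ.* δ) _ _ (begin
      indegree D v ℕ.+ n ℕ.* δ
        ≤⟨ ℕₚ.+-monoʳ-≤ (indegree D v) (n*c≤sum (δ≤ ∘ punchIn v)) ⟩
      indegree D v ℕ.+ sum (indegree D ∘ punchIn v)
        ≡⟨ sum-remove {i = v} (indegree D) ⟨
      arcs D
        ≡⟨ D≡F′ ⟩
      F′
        ≤⟨ upperBound n₁≤1+n min ⟩
      δ ℕ.+ n ℕ.* δ ℕ.+ a₁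
        ≡⟨ ℕₚ.+-assoc δ (n ℕ.* δ) a₁ ⟩
      δ ℕ.+ (n ℕ.* δ ℕ.+ a₁)
        ≡⟨ cong (δ ℕ.+_) (ℕₚ.+-comm (n ℕ.* δ) a₁) ⟩
      δ ℕ.+ (a₁ ℕ.+ n ℕ.* δ)
        ≡⟨ ℕₚ.+-assoc δ a₁ (n ℕ.* δ) ⟨
      δ ℕ.+ a₁ ℕ.+ n ℕ.* δ ∎)

    D-kernel = kernel D indegree≤ dom
    K≤ = proj₁ (proj₂ D-kernel)

    deleteOutside : ∃[ w ] w ∉ proj₁ D-kernel → δ ℕ.+ F ≤ F′
    deleteOutside (w , w∉K) = begin
      δ ℕ.+ F
        ≤⟨ ℕₚ.+-mono-≤ (δ≤ w) (least (delete D w , (λ uv vu → asym uv vu) ,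
             delete-dominating D w∉K (proj₂ (proj₂ D-kernel)) , refl)) ⟩
      indegree D w ℕ.+ arcs (delete D w)
        ≤⟨ arcs-delete D w ⟩
      arcs D
        ≡⟨ D≡F′ ⟩
      F′ ∎

  -- A sum in place of a maximum: it lies above the bounds required by `minExists`, `stepUp` and
  -- `stepDown`.
  threshold : ℕ
  threshold = n₁ ℕ.+ suc a₁ ℕ.+ kernelSize (δ ℕ.+ a₁) (δ ℕ.+ a₁)

  n₁≤threshold : n₁ ≤ threshold
  n₁≤threshold = ≤-trans (ℕₚ.m≤m+n n₁ (suc a₁)) (ℕₚ.m≤m+n _ _)

  a₁<threshold : a₁ < threshold
  a₁<threshold = ≤-trans (ℕₚ.m≤n+m (suc a₁) n₁) (ℕₚ.m≤m+n _ _)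

  eventuallyLinear : ∀ {F₀} → Min threshold F₀ → ∀ i → Min (i ℕ.+ threshold) (i ℕ.* δ ℕ.+ F₀)
  eventuallyLinear      min₀ zero    = min₀
  eventuallyLinear {F₀} min₀ (suc i) with minExists (≤-trans n₁≤threshold (ℕₚ.m≤n+m threshold (suc i)))
  ... | F′ , min′ = subst (Min (suc i ℕ.+ threshold))
    (trans (ℕₚ.≤-antisym (stepUp (beyond n₁≤threshold) (beyond a₁<threshold) min min′)
                         (stepDown (beyond n₁≤threshold) (beyond (ℕₚ.m≤n+m _ _)) min min′))
           (sym (ℕₚ.+-assoc δ (i ℕ.* δ) F₀)))
    min′
    where
    min = eventuallyLinear min₀ i
    beyond : ∀ {b} → b ≤ threshold → b ≤ i ℕ.+ threshold
    beyond b≤ = ≤-trans b≤ (ℕₚ.m≤n+m threshold i)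

intercept : ∀ (d i t f : ℤ) → i * d + f ≡ d * (i + t) + (f - d * t)
intercept = solve-∀

lemma5 : ∀ (k : ℕ) → k ≥ 2 → ∀ (δ : ℕ) → Isδ k δ →
    Σ[ c ∈ ℤ ] Σ[ n₀ ∈ ℕ ] (∀ (n : ℕ) → n ≥ n₀ →
    ∃[ F ] (IsF n k F × + F ≡ + δ * + n + c))
lemma5 (suc (suc j)) (s≤s (s≤s z≤n)) δ isδ@((_ , n₁ , D , (G , D-orients) , S@(k<n₁ , _) , v , refl) , _)
  -- The constant is the intercept of the line of slope `δ` through (n₀, F₀).
  = (+ F₀ - + δ * + n₀) , n₀ , λ n n₀≤n → linear n (n ∸ n₀) (ℕₚ.m∸n+n≡m n₀≤n)
  where
  -- Duplication starts from a digraph attaining `δ`; matching `refl` has identified `δ` with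
  -- `indegree D v`.
  exists : ∀ i → Realizable (i ℕ.+ n₁) (suc (suc j)) (i ℕ.* δ ℕ.+ arcs D)
  exists i =
    let E , RE , _ = iteratedDuplicate {v = v}
                       (IsOrientationOf.asym D-orients , propertyS⇒dominating D S , refl) i
    in E , RE

  minδ : ∀ {n} → suc (suc j) < n → (D : Digraph n) →
         Asymmetric (_⟶_ D) → Dominating (suc (suc j)) D → ∀ v → δ ≤ indegree D v
  minδ = δ≤indegree isδ

  n₀ : ℕ
  n₀ = threshold k<n₁ minδ exists

  n₁≤n₀ : n₁ ≤ n₀
  n₁≤n₀ = n₁≤threshold k<n₁ minδ exists

  F₀,min₀ : ∃[ F ] IsLeast (Realizable n₀ (suc (suc j))) F
  F₀,min₀ = minExists k<n₁ minδ exists n₁≤n₀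

  F₀ : ℕ
  F₀ = proj₁ F₀,min₀

  linear : ∀ n i → i ℕ.+ n₀ ≡ n →
           ∃[ F ] (IsF n (suc (suc j)) F × + F ≡ + δ * + n + (+ F₀ - + δ * + n₀))
  linear _ i refl =
    i ℕ.* δ ℕ.+ F₀ ,
    leastRealizable⇒IsF (ℕₚ.<-≤-trans k<n₁ (≤-trans n₁≤n₀ (ℕₚ.m≤n+m n₀ i)))
      (eventuallyLinear k<n₁ minδ exists (proj₂ F₀,min₀) i) ,
    (begin
      + (i ℕ.* δ ℕ.+ F₀)                              ≡⟨ cong (_+ + F₀) (pos-* i δ) ⟩
      + i * + δ + + F₀                                ≡⟨ intercept (+ δ) (+ i) (+ n₀) (+ F₀) ⟩
      + δ * (+ i + + n₀) + (+ F₀ - + δ * + n₀)        ≡⟨⟩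
      + δ * + (i ℕ.+ n₀) + (+ F₀ - + δ * + n₀)        ∎)
    where open ≡-Reasoning
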